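{- Let $r\ge 2$ and $t\ge 1$ be integers, and let $H$ be an $r$-partite $r$-graph. If $|E(H)|>\frac{t-1}{r}\,|\partial H|$, then $H$ contains (as a subhypergraph) every tight $r$-tree $T$ having $t$ edges.
   Context: An $r$-graph is an $r$-uniform hypergraph. An $r$-graph is $r$-partite if its vertex set can be partitioned into $r$ classes $V_1,\dots,V_r$ such that every edge contains exactly one vertex from each class. The shadow $\partial H$ of an $r$-graph $H$ is the set of all $(r-1)$-element sets contained in some edge of $H$. A tight $r$-tree is any $r$-graph constructed as follows: start with $T_1$ consisting of a single edge $e_1$ and its $r$ vertices; at each step $i\ge 2$ add a new edge $e_i$ containing exactly one new vertex $v_i$ (not in $T_{i-1}$) such that $e_i\setminus\{v_i\}$ is a subset of some edge of $T_{i-1}$, obtaining $T_i$. -}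

module Defs where

open import Data.Fin.Base using (Fin)
open import Data.Fin.Properties using (any?) renaming (_≟_ to _≟ᶠ_)
open import Data.Fin.Subset using (Subset; inside; outside; _∈_; _∉_; _⊆_; _∪_; _-_; ⁅_⁆; ⊤; ∣_∣)
open import Data.Fin.Subset.Properties using (_∈?_; _⊆?_)
open import Data.List.Base using (List; []; _∷_; _++_; map; filter; length)
import Data.List.Membership.Propositional as List
open import Data.List.Relation.Binary.Permutation.Propositional using (_↭_)
open import Data.List.Relation.Unary.All using (All)
open import Data.List.Relation.Unary.Any as Any using (Any)
open import Data.List.Relation.Unary.Unique.Propositional using (Unique)
open import Data.Nat.Base using (ℕ; zero; suc; _∸_)
open import Data.Nat.Properties using (_≟_)
open import Data.Product using (∃; ∃!; _×_)
import Data.Vec.Base as Vec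
open import Function.Definitions using (Injective)
open import Relation.Binary.PropositionalEquality using (_≡_)
open import Relation.Nullary.Decidable using (Dec; does; _×-dec_)

-- Finite r-graphs on the vertex set Fin n.  The edges form a set: they are
-- listed without repetition, and the order of the list plays no role.

record RGraph (r n : ℕ) : Set where
  field
    edges   : List (Subset n)
    unique  : Unique edges
    uniform : All (λ e → ∣ e ∣ ≡ r) edges

open RGraph public

_∈E_ : ∀ {r n} → Subset n → RGraph r n → Set
e ∈E H = e List.∈ edges H

∣E_∣ : ∀ {r n} → RGraph r n → ℕ
∣E H ∣ = length (edges H)

-- The colouring c encodes the partition; its fibres V_i = c⁻¹(i) are the
-- classes.

IsPartite : ∀ {r n} → RGraph r n → Set
IsPartite {r} {n} H =
  ∃ λ (c : Fin n → Fin r) →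
    ∀ e → e ∈E H → ∀ i → ∃! _≡_ λ v → v ∈ e × c v ≡ i

-- Every subset of Fin n, each listed exactly once.

allSubsets : ∀ n → List (Subset n)
allSubsets zero    = Vec.[] ∷ []
allSubsets (suc n) = map (inside Vec.∷_) (allSubsets n) ++ map (outside Vec.∷_) (allSubsets n)

InShadow : ∀ {r n} → RGraph r n → Subset n → Set
InShadow {r} H s = ∣ s ∣ ≡ r ∸ 1 × Any (s ⊆_) (edges H)

inShadow? : ∀ {r n} (H : RGraph r n) (s : Subset n) → Dec (InShadow H s)
inShadow? {r} H s = (∣ s ∣ ≟ r ∸ 1) ×-dec Any.any? (s ⊆?_) (edges H)

∂ : ∀ {r n} → RGraph r n → List (Subset n)
∂ {n = n} H = filter (inShadow? H) (allSubsets n)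

∣∂_∣ : ∀ {r n} → RGraph r n → ℕ
∣∂ H ∣ = length (∂ H)

-- TightConstruction r V es: the steps of the construction of a tight r-tree
-- with vertex set V and edges es, the most recently added edge first.  In
-- `grow`, v is the only new vertex of e, because e - v lies in the old edge f.

data TightConstruction (r : ℕ) {n : ℕ} : Subset n → List (Subset n) → Set where
  start : ∀ {e} → ∣ e ∣ ≡ r → TightConstruction r e (e ∷ [])
  grow  : ∀ {V es e f v} → TightConstruction r V es →
          ∣ e ∣ ≡ r → v ∈ e → v ∉ V → f List.∈ es → (e - v) ⊆ f →
          TightConstruction r (V ∪ ⁅ v ⁆) (e ∷ es)

IsTightTree : ∀ {r n} → RGraph r n → Set
IsTightTree {r} T = ∃ λ es → TightConstruction r ⊤ es × es ↭ edges T

image : ∀ {m n} → (Fin m → Fin n) → Subset m → Subset n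
image φ p = Vec.tabulate λ w → does (any? λ v → (v ∈? p) ×-dec (φ v ≟ᶠ w))

-- H contains a copy of T: some injection of vertices maps edges to edges.

_Contains_ : ∀ {r m n} → RGraph r n → RGraph r m → Set
_Contains_ {m = m} {n} H T =
  ∃ λ (φ : Fin m → Fin n) →
    Injective _≡_ _≡_ φ × (∀ e → e ∈E T → image φ e ∈E H)

{-# OPTIONS --safe #-}

-- Colour the vertices of the tree T so that every edge is rainbow, and let
-- kᵢ + 1 be the number of vertices of colour i; then Σ kᵢ = t - 1.  Matching
-- the colours of T with the classes of H by a permutation π, delete repeatedly
-- all edges of H through a shadow set that misses class π(i) and has degree at
-- most kᵢ.  When π runs through the rows of a Latin square, each shadow set
-- is charged t - 1 in total, so by averaging some π deletes at most
-- (t - 1)/r · |∂H| < |E(H)| edges.  In the nonempty rest, every remaining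
-- shadow set missing class π(i) has more than kᵢ extensions, while at most kᵢ
-- vertices of that class are occupied when T needs a new vertex of colour i:
-- T embeds greedily.
module Submission where

open import Defs
open import Algebra.Properties.CommutativeMonoid.Sum using (sum-permute; ∑-distrib-+)
open import Data.Bool.Base using (true; false)
open import Data.Fin.Base using (Fin; zero; suc; toℕ; fromℕ<)
open import Data.Fin.Permutation using (permutation)
open import Data.Fin.Properties using (any?; pigeonhole; toℕ-fromℕ<; toℕ-injective; toℕ<n) renaming (<⇒≢ to <ᶠ⇒≢; _≟_ to _≟ᶠ_; suc-injective to sucᶠ-injective)
open import Data.Fin.Subset using (Subset; inside; outside; _∈_; _∉_; _⊆_; _∪_; _-_; ⁅_⁆; ∣_∣)
open import Data.Fin.Subset.Properties
import Data.Integer.Base as ℤ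
import Data.Integer.Properties as ℤ
open import Data.List.Base using (List; []; _∷_; _++_; [_]; map; filter; length; lookup)
open import Data.List.Membership.Propositional using (find; lose) renaming (_∈_ to _∈ˡ_; _∉_ to _∉ˡ_)
open import Data.List.Membership.Propositional.Properties using (∈-filter⁺; ∈-filter⁻; ∈-map⁺; ∈-++⁺ˡ; ∈-++⁺ʳ; ∈-++⁻; ∈-∃++; ∈-lookup)
open import Data.List.Membership.DecPropositional using () renaming (_∈?_ to ∈ˡ-dec)
open import Data.List.Properties using (length-++; map-++)
open import Data.List.Relation.Binary.Permutation.Propositional using (↭-sym)
open import Data.List.Relation.Binary.Permutation.Propositional.Properties using (↭-length; ∈-resp-↭)
open import Data.List.Relation.Unary.All as All using (All)
open import Data.List.Relation.Unary.All.Properties using (¬All⇒Any¬)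
open import Data.List.Relation.Unary.Any as Any using (Any; here; there)
open import Data.List.Relation.Unary.Any.Properties using (lookup-index)
open import Data.List.Relation.Unary.AllPairs using (_∷_)
open import Data.List.Relation.Unary.Unique.Propositional using (Unique)
import Data.List.Relation.Unary.Unique.Propositional.Properties as Unique
open import Data.Nat.Base using (ℕ; zero; suc; _+_; _*_; _∸_; NonZero; _≤_; _<_; z≤n; s≤s)
open import Data.Nat.ListAction using () renaming (sum to sumˡ)
open import Data.Nat.ListAction.Properties using (sum-++)
open import Data.Nat.Properties
open import Data.Product using (∃; ∃!; _×_; _,_; proj₁; proj₂)
open import Data.Rational.Unnormalised.Base using (_/_; _>_; *<*) renaming (_*_ to _*ℚ_)
open import Data.Sum using (_⊎_; inj₁; inj₂)
open import Data.Vec.Base using ([]; _∷_; here; there)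
open import Data.Vec.Functional using (Vector; updateAt)
open import Data.Vec.Functional.Properties using (updateAt-updates; updateAt-minimal)
open import Data.Vec.Properties using ([]=⇒lookup; lookup⇒[]=; lookup∘tabulate)
open import Function.Base using (_∘_; const)
open import Function.Definitions using (Injective)
open import Relation.Binary.PropositionalEquality using (_≡_; _≢_; refl; sym; trans; cong; subst; subst₂; module ≡-Reasoning)
open import Relation.Nullary using (¬_; Dec; yes; no; contradiction)
open import Relation.Nullary.Decidable using (_×-dec_; _→-dec_; ¬?; does; dec-true)
open import Relation.Unary using (Decidable)
open import Algebra.Properties.Monoid.Sum +-0-monoid using (sum)

-- Finite sums and averaging

sum-updateAt-suc : ∀ {n} (t : Vector ℕ n) i → sum (updateAt t i suc) ≡ suc (sum t)
sum-updateAt-suc t zero    = refl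
sum-updateAt-suc t (suc i) = trans (cong (t zero +_) (sum-updateAt-suc (t ∘ suc) i)) (+-suc (t zero) _)

sum-const-0 : ∀ n → sum {n} (const 0) ≡ 0
sum-const-0 zero    = refl
sum-const-0 (suc n) = sum-const-0 n

sum<*⇒∃< : ∀ {n} (t : Vector ℕ n) N → sum t < n * N → ∃ λ i → t i < N
sum<*⇒∃< {suc n} t N Σt<nN with t zero <? N
... | yes t₀<N = zero , t₀<N
... | no  t₀≮N =
  let i , tᵢ<N = sum<*⇒∃< (t ∘ suc) N
        (+-cancelˡ-< N _ _ (≤-<-trans (+-monoˡ-≤ _ (≮⇒≥ t₀≮N)) Σt<nN))
  in suc i , tᵢ<N

-- Double counting: exchanging the two summations leaves column sums, all equal to `c`. A column
-- will collect the charges of one shadow set under all rows of the Latin square.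
sum-sumˡ : ∀ {n} {A : Set} (w : Fin n → A → ℕ) {c} → (∀ x → sum (λ i → w i x) ≡ c) →
           ∀ xs → sum (λ i → sumˡ (map (w i) xs)) ≡ c * length xs
sum-sumˡ {n} w {c} col []       = trans (sum-const-0 n) (sym (*-zeroʳ c))
sum-sumˡ {n} w {c} col (x ∷ xs) = begin
  sum (λ i → w i x + sumˡ (map (w i) xs))
    ≡⟨ ∑-distrib-+ +-0-commutativeMonoid (λ i → w i x) _ ⟩
  sum (λ i → w i x) + sum (λ i → sumˡ (map (w i) xs))
    ≡⟨ cong (_+ _) (col x) ⟩
  c + sum (λ i → sumˡ (map (w i) xs))
    ≡⟨ cong (c +_) (sum-sumˡ w col xs) ⟩
  c + c * length xs
    ≡⟨ *-suc c (length xs) ⟨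
  c * suc (length xs) ∎
  where open ≡-Reasoning

-- A symmetric Latin square of order q + 1

module LatinSquare (q : ℕ) where

  -- x + y + z ≡ -1 modulo q + 1, for representatives in [0, q].
  Balanced : ℕ → ℕ → Set
  Balanced s z = s + z ≡ q ⊎ s + z ≡ q + suc q

  balanced-unique : ∀ {s z z′} → z < suc q → z′ < suc q → Balanced s z → Balanced s z′ → z ≡ z′
  balanced-unique {s} _ _ (inj₁ p) (inj₁ p′) = +-cancelˡ-≡ s _ _ (trans p (sym p′))
  balanced-unique {s} _ _ (inj₂ p) (inj₂ p′) = +-cancelˡ-≡ s _ _ (trans p (sym p′))
  -- The two sums differ by q + 1, so z′ = z + (q + 1), which is out of range.
  balanced-unique {s} {z} {z′} z<r z′<r (inj₁ p) (inj₂ p′) = contradiction z′<r (≤⇒≯ (subst (suc q ≤_) z+r≡z′ (m≤n+m (suc q) z)))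
    where
    z+r≡z′ : z + suc q ≡ z′
    z+r≡z′ = +-cancelˡ-≡ s _ _ (trans (sym (+-assoc s z _)) (trans (cong (_+ suc q) p) (sym p′)))
  balanced-unique {s} z<r z′<r b@(inj₂ _) b′@(inj₁ _) = sym (balanced-unique {s} z′<r z<r b′ b)

  latin : (x y : Fin (suc q)) → ∃ λ (z : Fin (suc q)) → Balanced (toℕ x + toℕ y) (toℕ z)
  latin x y with toℕ x + toℕ y ≤? q
  ... | yes s≤q = fromℕ< z<r , inj₁ (trans (cong (toℕ x + toℕ y +_) (toℕ-fromℕ< z<r)) (m+[n∸m]≡n s≤q))
    where
    z<r : q ∸ (toℕ x + toℕ y) < suc q
    z<r = s≤s (m∸n≤m q (toℕ x + toℕ y))
  ... | no s≰q = fromℕ< z<r , inj₂ (trans (cong (toℕ x + toℕ y +_) (toℕ-fromℕ< z<r)) (m+[n∸m]≡n s≤2q+1))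
    where
    s≤2q+1 : toℕ x + toℕ y ≤ q + suc q
    s≤2q+1 = +-mono-≤ (≤-pred (toℕ<n x)) (<⇒≤ (toℕ<n y))
    z<r : q + suc q ∸ (toℕ x + toℕ y) < suc q
    z<r = s≤s (≤-trans (∸-monoʳ-≤ (q + suc q) (≰⇒> s≰q)) (≤-reflexive (m+n∸n≡m q (suc q))))

  -- The Latin square x ⊙ y = -1 - x - y is symmetric with involutive rows, so
  -- row a is its own inverse permutation and a ↦ a ⊙ i is a bijection.
  infixl 6 _⊙_
  _⊙_ : Fin (suc q) → Fin (suc q) → Fin (suc q)
  x ⊙ y = proj₁ (latin x y)

  ⊙-comm : ∀ x y → x ⊙ y ≡ y ⊙ x
  ⊙-comm x y = toℕ-injective (balanced-unique {toℕ x + toℕ y} (toℕ<n (x ⊙ y)) (toℕ<n (y ⊙ x)) (proj₂ (latin x y))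
    (subst (λ s → Balanced s (toℕ (y ⊙ x))) (+-comm (toℕ y) (toℕ x)) (proj₂ (latin y x))))

  -- The condition is symmetric in the second and third entries, so y completes the pair x, x ⊙ y,
  -- and completions are unique.
  ⊙-involutive : ∀ x y → x ⊙ (x ⊙ y) ≡ y
  ⊙-involutive x y = toℕ-injective (balanced-unique {toℕ x + toℕ (x ⊙ y)} (toℕ<n (x ⊙ (x ⊙ y))) (toℕ<n y)
    (proj₂ (latin x (x ⊙ y))) (swap (proj₂ (latin x y))))
    where
    exchange : ∀ a b c → a + c + b ≡ a + b + c
    exchange a b c = trans (+-assoc a c b) (trans (cong (a +_) (+-comm c b)) (sym (+-assoc a b c)))
    swap : Balanced (toℕ x + toℕ y) (toℕ (x ⊙ y)) → Balanced (toℕ x + toℕ (x ⊙ y)) (toℕ y)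
    swap (inj₁ p) = inj₁ (trans (exchange (toℕ x) _ _) p)
    swap (inj₂ p) = inj₂ (trans (exchange (toℕ x) _ _) p)

  -- As the row varies, class i is matched with every colour once, so a shadow set missing class i
  -- is charged each entry of `t` exactly once.
  sum-⊙ : ∀ (t : Vector ℕ (suc q)) i → sum (λ a → t (a ⊙ i)) ≡ sum t
  sum-⊙ t i = sym (sum-permute +-0-commutativeMonoid t (permutation (_⊙ i) (_⊙ i) inv inv))
    where
    inv : ∀ a → a ⊙ i ⊙ i ≡ a
    inv a = trans (⊙-comm (a ⊙ i) i) (trans (cong (i ⊙_) (⊙-comm a i)) (⊙-involutive i a))

-- Lists

length≤filter+filter¬ : ∀ {A : Set} {P : A → Set} (P? : Decidable P) xs →
                        length xs ≤ length (filter P? xs) + length (filter (¬? ∘ P?) xs)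
length≤filter+filter¬ P? []       = z≤n
length≤filter+filter¬ P? (x ∷ xs) with ih ← length≤filter+filter¬ P? xs | does (P? x)
... | true  = s≤s ih
... | false = ≤-trans (s≤s ih) (≤-reflexive (sym (+-suc _ _)))

lookup-injective : ∀ {A : Set} {xs : List A} → Unique xs → Injective _≡_ _≡_ (lookup xs)
lookup-injective (x≢ ∷ u) {zero}  {zero}  _ = refl
lookup-injective (x≢ ∷ u) {zero}  {suc j} p = contradiction p (All.lookup x≢ (∈-lookup j))
lookup-injective (x≢ ∷ u) {suc i} {zero}  p = contradiction (sym p) (All.lookup x≢ (∈-lookup i))
lookup-injective (x≢ ∷ u) {suc i} {suc j} p = cong suc (lookup-injective u p)

-- If every value occurred in `ys`, two indices would share a position there by the pigeonhole
-- principle, and hence a value.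
injection-avoids : ∀ {N n} (f : Fin N → Fin n) → Injective _≡_ _≡_ f →
                   ∀ ys → length ys < N → ∃ λ i → f i ∉ˡ ys
injection-avoids f f-inj ys ∣ys∣<N with any? (λ i → ¬? (∈ˡ-dec _≟ᶠ_ (f i) ys))
... | yes p = p
... | no ¬p = contradiction (f-inj fᵢ≡fⱼ) (<ᶠ⇒≢ i<j)
  where
  f∈ : ∀ i → f i ∈ˡ ys
  f∈ i with ∈ˡ-dec _≟ᶠ_ (f i) ys
  ... | yes p = p
  ... | no q  = contradiction (i , q) ¬p
  collision = pigeonhole ∣ys∣<N (λ i → Any.index (f∈ i))
  i = proj₁ collision
  j = proj₁ (proj₂ collision)
  i<j = proj₁ (proj₂ (proj₂ collision))
  fᵢ≡fⱼ : f i ≡ f j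
  fᵢ≡fⱼ = trans (lookup-index (f∈ i)) (trans (cong (lookup ys) (proj₂ (proj₂ (proj₂ collision)))) (sym (lookup-index (f∈ j))))

-- Pruning low degrees in an incidence relation

degree : {A B : Set} {_≲_ : B → A → Set} → (∀ s e → Dec (s ≲ e)) → List A → B → ℕ
degree _≲?_ E s = length (filter (s ≲?_) E)

module Pruning {A B : Set} {_≲_ : B → A → Set} (_≲?_ : ∀ s e → Dec (s ≲ e)) (w : B → ℕ) where

  -- Vacuous for an `s` below no element of `E`: a set whose edges are all deleted counts as thick.
  Thick : List A → B → Set
  Thick E s = Any (s ≲_) E → w s < degree _≲?_ E s

  thick? : ∀ E → Decidable (Thick E)
  thick? E s = Any.any? (s ≲?_) E →-dec (w s <? degree _≲?_ E s)

  -- Discarding a set `s` that is not thick, with the at most `w s` edges above it, keeps the total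
  -- weight below the number of edges; in particular some edge always remains. `N` bounds the number
  -- of sets left and makes the recursion structural.
  prune : ∀ N S E → length S ≤ N → sumˡ (map w S) < length E → Unique E →
          ∃ λ E′ → 0 < length E′ × (∀ {e} → e ∈ˡ E′ → e ∈ˡ E) × Unique E′ ×
                   (∀ {s} → s ∈ˡ S → Thick E′ s)
  prune N S E ∣S∣≤N w<E uE with All.all? (thick? E) S
  ... | yes thick = E , ≤-<-trans z≤n w<E , (λ e∈ → e∈) , uE , All.lookup thick
  ... | no ¬thick with find (¬All⇒Any¬ (thick? E) S ¬thick)
  ...   | s , s∈S , ¬s with ∈-∃++ s∈S
  prune (suc N) _ E ∣S∣≤N w<E uE | no _ | s , _ , ¬s | xs , ys , refl
      = let E′ , E′>0 , E′⊆ , uE′ , thick = prune N (xs ++ ys) E₁ ∣S₁∣≤N w<E₁ (Unique.filter⁺ (¬? ∘ (s ≲?_)) uE)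
        in E′ , E′>0 , proj₁ ∘ ∈-filter⁻ (¬? ∘ (s ≲?_)) ∘ E′⊆ , uE′ , extend E′⊆ thick
    where
    E₁ = filter (¬? ∘ (s ≲?_)) E
    ∣S₁∣≤N : length (xs ++ ys) ≤ N
    ∣S₁∣≤N = ≤-pred (≤-trans (≤-reflexive (sym (trans (length-++ xs) (trans (+-suc _ _) (cong suc (sym (length-++ xs))))))) ∣S∣≤N)
    degree≤w : degree _≲?_ E s ≤ w s
    degree≤w with degree _≲?_ E s ≤? w s
    ... | yes p = p
    ... | no ¬p = contradiction (λ _ → ≰⇒> ¬p) ¬s
    weights : sumˡ (map w (xs ++ [ s ] ++ ys)) ≡ w s + sumˡ (map w (xs ++ ys))
    weights = begin
      sumˡ (map w (xs ++ [ s ] ++ ys))           ≡⟨ cong sumˡ (map-++ w xs _) ⟩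
      sumˡ (map w xs ++ w s ∷ map w ys)          ≡⟨ sum-++ (map w xs) _ ⟩
      sumˡ (map w xs) + (w s + sumˡ (map w ys))  ≡⟨ +-assoc (sumˡ (map w xs)) (w s) _ ⟨
      sumˡ (map w xs) + w s + sumˡ (map w ys)    ≡⟨ cong (_+ sumˡ (map w ys)) (+-comm (sumˡ (map w xs)) (w s)) ⟩
      w s + sumˡ (map w xs) + sumˡ (map w ys)    ≡⟨ +-assoc (w s) _ _ ⟩
      w s + (sumˡ (map w xs) + sumˡ (map w ys))  ≡⟨ cong (w s +_) (sum-++ (map w xs) _) ⟨
      w s + sumˡ (map w xs ++ map w ys)          ≡⟨ cong (λ z → w s + sumˡ z) (map-++ w xs ys) ⟨
      w s + sumˡ (map w (xs ++ ys)) ∎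
      where open ≡-Reasoning
    w<E₁ : sumˡ (map w (xs ++ ys)) < length E₁
    w<E₁ = +-cancelˡ-< (w s) _ _ (begin-strict
      w s + sumˡ (map w (xs ++ ys))      ≡⟨ weights ⟨
      sumˡ (map w (xs ++ [ s ] ++ ys))   <⟨ w<E ⟩
      length E                           ≤⟨ length≤filter+filter¬ (s ≲?_) E ⟩
      degree _≲?_ E s + length E₁             ≤⟨ +-monoˡ-≤ _ degree≤w ⟩
      w s + length E₁                    ∎)
      where open ≤-Reasoning
    extend : ∀ {E′} → (∀ {e} → e ∈ˡ E′ → e ∈ˡ E₁) → (∀ {x} → x ∈ˡ xs ++ ys → Thick E′ x) →
             ∀ {x} → x ∈ˡ xs ++ [ s ] ++ ys → Thick E′ x
    extend E′⊆ thick x∈ any with ∈-++⁻ xs x∈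
    ... | inj₁ x∈xs         = thick (∈-++⁺ˡ x∈xs) any
    ... | inj₂ (there x∈ys) = thick (∈-++⁺ʳ xs x∈ys) any
    -- No edge above the discarded `s` survives, so `s` is thick vacuously.
    ... | inj₂ (here refl)  = let e , e∈ , s≲e = find any in
          contradiction s≲e (proj₂ (∈-filter⁻ (¬? ∘ (s ≲?_)) {xs = E} (E′⊆ e∈)))
  -- The list contains `s`, so its length is not at most 0; splitting the prefix exposes the
  -- successor.
  prune zero _ E ∣S∣≤N w<E uE | no _ | s , _ , ¬s | [] , ys , refl = contradiction ∣S∣≤N λ ()
  prune zero _ E ∣S∣≤N w<E uE | no _ | s , _ , ¬s | _ ∷ _ , ys , refl = contradiction ∣S∣≤N λ ()

-- Subsets of Fin n

∣p∣≡1+∣p-x∣ : ∀ {n} {x : Fin n} {p} → x ∈ p → ∣ p ∣ ≡ suc ∣ p - x ∣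
∣p∣≡1+∣p-x∣ {p = _ ∷ p}       here       = cong (suc ∘ ∣_∣) (sym (p─⊥≡p p))
∣p∣≡1+∣p-x∣ {p = inside ∷ p}  (there x∈) = cong suc (∣p∣≡1+∣p-x∣ x∈)
∣p∣≡1+∣p-x∣ {p = outside ∷ p} (there x∈) = ∣p∣≡1+∣p-x∣ x∈

x∉p-x : ∀ {n} (x : Fin n) p → x ∉ p - x
x∉p-x zero    (_ ∷ p) ()
x∉p-x (suc x) (_ ∷ p) (there x∈) = x∉p-x x p x∈

p-x⊆p : ∀ {n} (p : Subset n) x → p - x ⊆ p
p-x⊆p p x = p─q⊆p p ⁅ x ⁆

-- Being larger, q has an element y outside p; a second one would make p a proper subset of q - y,
-- which has the same size.
subset-of-codegree-one : ∀ {n} {p q : Subset n} → p ⊆ q → ∣ q ∣ ≡ suc ∣ p ∣ →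
  ∃ λ y → y ∈ q × y ∉ p × (∀ {z} → z ∈ q → z ≢ y → z ∈ p)
subset-of-codegree-one {p = p} {q} p⊆q ∣q∣≡ with any? (λ y → (y ∈? q) ×-dec ¬? (y ∈? p))
... | no none = contradiction (p⊆q⇒∣p∣≤∣q∣ q⊆p) (<⇒≱ (≤-reflexive (sym ∣q∣≡)))
  where
  q⊆p : q ⊆ p
  q⊆p {z} z∈q with z ∈? p
  ... | yes z∈p = z∈p
  ... | no  z∉p = contradiction (z , z∈q , z∉p) none
... | yes (y , y∈q , y∉p) = y , y∈q , y∉p , rest
  where
  p⊆q-y : p ⊆ q - y
  p⊆q-y x∈p = x∈p∧x≢y⇒x∈p-y (p⊆q x∈p) λ { refl → y∉p x∈p }
  rest : ∀ {z} → z ∈ q → z ≢ y → z ∈ p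
  rest {z} z∈q z≢y with z ∈? p
  ... | yes z∈p = z∈p
  ... | no  z∉p = contradiction
    (p⊂q⇒∣p∣<∣q∣ (p⊆q-y , z , x∈p∧x≢y⇒x∈p-y z∈q z≢y , z∉p))
    (≤⇒≯ (≤-reflexive (suc-injective (trans (sym (∣p∣≡1+∣p-x∣ y∈q)) ∣q∣≡))))

enumerate : ∀ {n} (p : Subset n) → Fin ∣ p ∣ → Fin n
enumerate (inside  ∷ p) zero    = zero
enumerate (inside  ∷ p) (suc i) = suc (enumerate p i)
enumerate (outside ∷ p) i       = suc (enumerate p i)

enumerate-∈ : ∀ {n} (p : Subset n) i → enumerate p i ∈ p
enumerate-∈ (inside  ∷ p) zero    = here
enumerate-∈ (inside  ∷ p) (suc i) = there (enumerate-∈ p i)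
enumerate-∈ (outside ∷ p) i       = there (enumerate-∈ p i)

enumerate-injective : ∀ {n} (p : Subset n) → Injective _≡_ _≡_ (enumerate p)
enumerate-injective (inside  ∷ p) {zero}  {zero}  _  = refl
enumerate-injective (inside  ∷ p) {suc i} {suc j} eq = cong suc (enumerate-injective p (sucᶠ-injective eq))
enumerate-injective (outside ∷ p) eq = enumerate-injective p (sucᶠ-injective eq)

enumerate-surjective : ∀ {n} {p : Subset n} {x} → x ∈ p → ∃ λ i → enumerate p i ≡ x
enumerate-surjective {p = _ ∷ p}       here       = zero , refl
enumerate-surjective {p = inside ∷ p}  (there x∈) = let i , eq = enumerate-surjective x∈ in suc i , cong suc eq
enumerate-surjective {p = outside ∷ p} (there x∈) = let i , eq = enumerate-surjective x∈ in i , cong suc eq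

∈-allSubsets : ∀ {n} (p : Subset n) → p ∈ˡ allSubsets n
∈-allSubsets []            = here refl
∈-allSubsets (inside  ∷ p) = ∈-++⁺ˡ (∈-map⁺ _ (∈-allSubsets p))
∈-allSubsets (outside ∷ p) = ∈-++⁺ʳ _ (∈-map⁺ _ (∈-allSubsets p))

∈-image⁺ : ∀ {m n} (φ : Fin m → Fin n) {p x} → x ∈ p → φ x ∈ image φ p
∈-image⁺ φ {p} {x} x∈p = lookup⇒[]= (φ x) (image φ p)
  (trans (lookup∘tabulate _ (φ x)) (dec-true (any? λ v → (v ∈? p) ×-dec (φ v ≟ᶠ φ x)) (x , x∈p , refl)))

∈-image⁻ : ∀ {m n} (φ : Fin m → Fin n) {p y} → y ∈ image φ p → ∃ λ x → x ∈ p × φ x ≡ y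
-- The equation is abstracted together with the decision, so in the negative case it equates `false`
-- with `true`.
∈-image⁻ φ {p} {y} y∈ with any? (λ v → (v ∈? p) ×-dec (φ v ≟ᶠ y)) | trans (sym (lookup∘tabulate (λ w → does (any? λ v → (v ∈? p) ×-dec (φ v ≟ᶠ w))) y)) ([]=⇒lookup y∈)
... | yes found | _ = found
... | no _      | ()

image-⊆ : ∀ {m n} {φ φ′ : Fin m → Fin n} {p} → (∀ {x} → x ∈ p → φ x ≡ φ′ x) → image φ p ⊆ image φ′ p
image-⊆ {φ = φ} {φ′} {p} φ≡φ′ y∈ =
  let x , x∈p , φx≡y = ∈-image⁻ φ y∈
  in subst (_∈ image φ′ p) (trans (sym (φ≡φ′ x∈p)) φx≡y) (∈-image⁺ φ′ x∈p)

image-cong : ∀ {m n} {φ φ′ : Fin m → Fin n} {p} → (∀ {x} → x ∈ p → φ x ≡ φ′ x) → image φ p ≡ image φ′ p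
image-cong φ≡φ′ = ⊆-antisym (image-⊆ φ≡φ′) (image-⊆ (sym ∘ φ≡φ′))

-- Rainbow edges

Rainbow : ∀ {r n} → (Fin n → Fin r) → Subset n → Set
Rainbow c e = ∀ i → ∃! _≡_ λ v → v ∈ e × c v ≡ i

module _ {r n} {c : Fin n → Fin r} {e} (R : Rainbow c e) where

  vertex : Fin r → Fin n
  vertex i = proj₁ (R i)

  vertex-∈ : ∀ i → vertex i ∈ e
  vertex-∈ i = proj₁ (proj₁ (proj₂ (R i)))

  vertex-colour : ∀ i → c (vertex i) ≡ i
  vertex-colour i = proj₂ (proj₁ (proj₂ (R i)))

  vertex-unique : ∀ {i x} → x ∈ e → c x ≡ i → vertex i ≡ x
  vertex-unique x∈e cx≡i = proj₂ (proj₂ (R _)) (x∈e , cx≡i)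

  rainbow-injective : ∀ {x y} → x ∈ e → y ∈ e → c x ≡ c y → x ≡ y
  rainbow-injective x∈e y∈e cx≡cy = trans (sym (vertex-unique x∈e cx≡cy)) (vertex-unique y∈e refl)

  rainbow-cong : ∀ {c′} → (∀ {x} → x ∈ e → c x ≡ c′ x) → Rainbow c′ e
  rainbow-cong c≡c′ i = vertex i , (vertex-∈ i , trans (sym (c≡c′ (vertex-∈ i))) (vertex-colour i)) ,
    λ (x∈e , c′x≡i) → vertex-unique x∈e (trans (c≡c′ x∈e) c′x≡i)

rainbow-⊆ : ∀ {r n} {c : Fin n → Fin r} {e f} → Rainbow c e → Rainbow c f →
            (∀ i → ∃ λ x → x ∈ e × x ∈ f × c x ≡ i) → e ⊆ f
rainbow-⊆ {c = c} {f = f} Re Rf common {x} x∈e =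
  let y , y∈e , y∈f , cy≡cx = common (c x)
  in subst (_∈ f) (rainbow-injective Re y∈e x∈e cy≡cx) y∈f

rainbow-≡ : ∀ {r n} {c : Fin n → Fin r} {e f} → Rainbow c e → Rainbow c f →
            (∀ i → ∃ λ x → x ∈ e × x ∈ f × c x ≡ i) → e ≡ f
rainbow-≡ Re Rf common = ⊆-antisym (rainbow-⊆ Re Rf common)
  (rainbow-⊆ Rf Re λ i → let x , x∈e , x∈f , cx≡i = common i in x , x∈f , x∈e , cx≡i)

-- Both edges contain g - y, which meets every class except that of y, and they share u in the
-- latter. So an edge through g - y is determined by its vertex in the class of y.
rainbow-≡-remove : ∀ {r n} {c : Fin n → Fin r} {e f g y} → Rainbow c e → Rainbow c f → Rainbow c g →
  g - y ⊆ e → g - y ⊆ f → (∃ λ u → u ∈ e × u ∈ f × c u ≡ c y) → e ≡ f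
rainbow-≡-remove {c = c} {y = y} Re Rf Rg ⊆e ⊆f (u , u∈e , u∈f , cu≡cy) = rainbow-≡ Re Rf common
  where
  common : ∀ i → ∃ λ x → x ∈ _ × x ∈ _ × c x ≡ i
  common i with i ≟ᶠ c y
  ... | yes i≡cy = u , u∈e , u∈f , trans cu≡cy (sym i≡cy)
  ... | no  i≢cy = vertex Rg i , ⊆e x∈g-y , ⊆f x∈g-y , vertex-colour Rg i
    where
    x∈g-y = x∈p∧x≢y⇒x∈p-y (vertex-∈ Rg i) λ x≡y → i≢cy (trans (sym (vertex-colour Rg i)) (cong c x≡y))

rainbow-colouring : ∀ {r n} (e : Subset n) → ∣ e ∣ ≡ r → Fin r → ∃ λ (χ : Fin n → Fin r) → Rainbow χ e
rainbow-colouring {n = n} e refl i₀ = χ , λ i → enumerate e i , (enumerate-∈ e i , χ-enumerate i) , only i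
  where
  χ : Fin n → Fin ∣ e ∣
  χ x with any? (λ i → enumerate e i ≟ᶠ x)
  ... | yes (i , _) = i
  -- Default colour off `e`.
  ... | no _        = i₀
  χ-enumerate : ∀ i → χ (enumerate e i) ≡ i
  χ-enumerate i with any? (λ j → enumerate e j ≟ᶠ enumerate e i)
  ... | yes (j , eq) = enumerate-injective e eq
  ... | no ¬p        = contradiction (i , refl) ¬p
  only : ∀ i {y} → y ∈ e × χ y ≡ i → enumerate e i ≡ y
  only i (y∈e , refl) with enumerate-surjective y∈e
  ... | j , refl = cong (enumerate e) (χ-enumerate j)

-- `zero` is a junk value for sets meeting every class.
missing : ∀ {q n} → (Fin n → Fin (suc q)) → Subset n → Fin (suc q)
missing c s with any? (λ i → ¬? (any? λ v → (v ∈? s) ×-dec (c v ≟ᶠ i)))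
... | yes (i , _) = i
... | no _        = zero

-- Any class other than that of v keeps its vertex, so the class found by the search can only be
-- that of v.
missing-remove : ∀ {q n} {c : Fin n → Fin (suc q)} {e v} → Rainbow c e → v ∈ e → missing c (e - v) ≡ c v
missing-remove {c = c} {e} {v} R v∈e with any? (λ i → ¬? (any? λ x → (x ∈? (e - v)) ×-dec (c x ≟ᶠ i)))
... | yes (i , absent) with vertex R i ≟ᶠ v
...   | yes x≡v = trans (sym (vertex-colour R i)) (cong c x≡v)
...   | no  x≢v = contradiction (vertex R i , x∈p∧x≢y⇒x∈p-y (vertex-∈ R i) x≢v , vertex-colour R i) absent
missing-remove {c = c} {e} {v} R v∈e | no ¬absent = contradiction (c v , absent) ¬absent
  where
  absent : ¬ ∃ λ x → x ∈ e - v × c x ≡ c v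
  absent (x , x∈ , cx≡cv) with rainbow-injective R (p-x⊆p e v x∈) v∈e cx≡cv
  ... | refl = x∉p-x v e x∈

-- Tight trees

updateAt-const-≢ : ∀ {A : Set} {n} (f : Vector A n) {v x a} → x ≢ v → updateAt f v (const a) x ≡ f x
updateAt-const-≢ f {v} {x} x≢v = updateAt-minimal x v f x≢v

construction-uniform : ∀ {r n} {V : Subset n} {es f} → TightConstruction r V es → f ∈ˡ es → ∣ f ∣ ≡ r
construction-uniform (start ∣e∣≡r)          (here refl) = ∣e∣≡r
construction-uniform (grow d ∣e∣≡r _ _ _ _) (here refl) = ∣e∣≡r
construction-uniform (grow d _ _ _ _ _)     (there f∈)  = construction-uniform d f∈

construction-⊆ : ∀ {r n} {V : Subset n} {es f} → TightConstruction r V es → f ∈ˡ es → f ⊆ V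
construction-⊆ (start _) (here refl) = λ x∈ → x∈
construction-⊆ (grow {V = V} {e = e} {v = v} d _ _ _ f∈ e-v⊆f) (here refl) {x} x∈e with x ≟ᶠ v
... | yes refl = q⊆p∪q V ⁅ v ⁆ (x∈⁅x⁆ v)
... | no  x≢v  = p⊆p∪q ⁅ v ⁆ (construction-⊆ d f∈ (e-v⊆f (x∈p∧x≢y⇒x∈p-y x∈e x≢v)))
construction-⊆ (grow {v = v} d _ _ _ _ _) (there f∈) = p⊆p∪q ⁅ v ⁆ ∘ construction-⊆ d f∈

∈∪⁅⁆⁻ : ∀ {n} {V : Subset n} {v x} → x ∈ V ∪ ⁅ v ⁆ → x ∈ V ⊎ x ≡ v
∈∪⁅⁆⁻ {V = V} {v} x∈ with x∈p∪q⁻ V ⁅ v ⁆ x∈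
... | inj₁ x∈V = inj₁ x∈V
... | inj₂ x∈v = inj₂ (x∈⁅y⁆⇒x≡y v x∈v)

-- The new edge arises from f by replacing one vertex y by v, so v receives the colour of y. Old
-- edges avoid v and stay rainbow.
tight-tree-colouring : ∀ {q n} {V : Subset n} {es} → TightConstruction (suc q) V es →
                       ∃ λ (χ : Fin n → Fin (suc q)) → ∀ {e} → e ∈ˡ es → Rainbow χ e
tight-tree-colouring (start {e} ∣e∣≡r) =
  let χ , R = rainbow-colouring e ∣e∣≡r zero in χ , λ { (here refl) → R }
tight-tree-colouring {q} {n} (grow {V} {es} {e} {f} {v} d ∣e∣≡r v∈e v∉V f∈ e-v⊆f)
  with χ , R ← tight-tree-colouring d
  with y , y∈f , y∉e-v , f-y⊆e-v ← subset-of-codegree-one e-v⊆f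
         (trans (construction-uniform d f∈) (trans (sym ∣e∣≡r) (∣p∣≡1+∣p-x∣ v∈e)))
  = χ′ , λ { (here refl) → new ; (there e′∈) → rainbow-cong (R e′∈) (old ∘ construction-⊆ d e′∈) }
  where
  χ′ : Fin n → Fin (suc q)
  χ′ = updateAt χ v (const (χ y))
  χ′v : χ′ v ≡ χ y
  χ′v = updateAt-updates v χ
  old : ∀ {x} → x ∈ V → χ x ≡ χ′ x
  old x∈V = sym (updateAt-const-≢ χ λ { refl → v∉V x∈V })
  f-old : ∀ {x} → x ∈ f → χ x ≡ χ′ x
  f-old = old ∘ construction-⊆ d f∈
  new : Rainbow χ′ e
  new i with i ≟ᶠ χ y
  ... | yes refl = v , (v∈e , χ′v) , only
    where
    only : ∀ {x} → x ∈ e × χ′ x ≡ χ y → v ≡ x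
    only {x} (x∈e , χ′x≡) with x ≟ᶠ v
    ... | yes x≡v = sym x≡v
    -- As f is rainbow, a vertex of e - v with the colour of y is y itself, which e - v does not
    -- contain.
    ... | no  x≢v with x∈e-v ← x∈p∧x≢y⇒x∈p-y x∈e x≢v
                  with refl ← rainbow-injective (R f∈) (e-v⊆f x∈e-v) y∈f (trans (f-old (e-v⊆f x∈e-v)) χ′x≡)
                  = contradiction x∈e-v y∉e-v
  ... | no i≢χy = w , (p-x⊆p e v w∈e-v , trans (sym (f-old w∈f)) (vertex-colour (R f∈) i)) , only
    where
    w = vertex (R f∈) i
    w∈f = vertex-∈ (R f∈) i
    w∈e-v = f-y⊆e-v w∈f λ w≡y → i≢χy (trans (sym (vertex-colour (R f∈) i)) (cong χ w≡y))
    only : ∀ {x} → x ∈ e × χ′ x ≡ i → w ≡ x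
    only {x} (x∈e , χ′x≡i) with x ≟ᶠ v
    ... | yes refl = contradiction (trans (sym χ′x≡i) χ′v) i≢χy
    ... | no  x≢v  with x∈f ← e-v⊆f (x∈p∧x≢y⇒x∈p-y x∈e x≢v)
                   = vertex-unique (R f∈) x∈f (trans (f-old x∈f) χ′x≡i)

-- growthCount χ d i + 1 is the number of vertices of colour i, because the
-- first edge has one vertex of each colour.
growthCount : ∀ {r n} {V : Subset n} {es} → (Fin n → Fin r) → TightConstruction r V es → Vector ℕ r
growthCount χ (start _)                  = const 0
growthCount χ (grow {v = v} d _ _ _ _ _) = updateAt (growthCount χ d) (χ v) suc

suc-sum-growthCount : ∀ {r n} {V : Subset n} {es} (χ : Fin n → Fin r) (d : TightConstruction r V es) →
                      suc (sum (growthCount χ d)) ≡ length es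
suc-sum-growthCount {r} χ (start _)                  = cong suc (sum-const-0 r)
suc-sum-growthCount     χ (grow {v = v} d _ _ _ _ _) =
  cong suc (trans (sum-updateAt-suc (growthCount χ d) (χ v)) (suc-sum-growthCount χ d))

≤-updateAt-suc : ∀ {n} (t : Vector ℕ n) i j → t j ≤ updateAt t i suc j
≤-updateAt-suc t i j with j ≟ᶠ i
... | yes refl = ≤-trans (n≤1+n _) (≤-reflexive (sym (updateAt-updates i t)))
... | no  j≢i  = ≤-reflexive (sym (updateAt-minimal j i t j≢i))

-- Greedy embedding

-- Tree colour j is matched with class a ⊙ j; rows being involutive, class i carries tree colour a ⊙
-- i. `K j` bounds the vertices of colour j added after the first edge.
module Greedy {q n : ℕ} (c : Fin n → Fin (suc q)) (E : List (Subset n)) (E-unique : Unique E)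
  (E-rainbow : ∀ {e} → e ∈ˡ E → Rainbow c e) (E>0 : 0 < length E)
  (a : Fin (suc q)) (K : Vector ℕ (suc q)) where

  open LatinSquare q

  -- Distinct edges through g - y have distinct tips in the class of y, so there are more tips than
  -- entries of `ys`.
  extend-edge : ∀ {g y} ys → g ∈ˡ E → length ys < degree _⊆?_ E (g - y) →
                ∃ λ f → f ∈ˡ E × g - y ⊆ f × ∃ λ u → u ∈ f × c u ≡ c y × u ∉ˡ ys
  extend-edge {g} {y} ys g∈E ys<deg =
    let i , u∉ys = injection-avoids tip tip-injective ys ys<deg
    in lookup F i , F⊆E i , F⊇ i , tip i , vertex-∈ (R i) (c y) , vertex-colour (R i) (c y) , u∉ys
    where
    F = filter ((g - y) ⊆?_) E
    F⊆E : ∀ i → lookup F i ∈ˡ E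
    F⊆E i = proj₁ (∈-filter⁻ ((g - y) ⊆?_) (∈-lookup i))
    F⊇ : ∀ i → g - y ⊆ lookup F i
    F⊇ i = proj₂ (∈-filter⁻ ((g - y) ⊆?_) {xs = E} (∈-lookup i))
    R : ∀ i → Rainbow c (lookup F i)
    R i = E-rainbow (F⊆E i)
    tip : Fin (length F) → Fin n
    tip i = vertex (R i) (c y)
    tip-injective : Injective _≡_ _≡_ tip
    tip-injective {i} {j} eq = lookup-injective (Unique.filter⁺ ((g - y) ⊆?_) E-unique)
      (rainbow-≡-remove (R i) (R j) (E-rainbow g∈E) (F⊇ i) (F⊇ j)
        (tip i , vertex-∈ (R i) (c y) , subst (_∈ lookup F j) (sym eq) (vertex-∈ (R j) (c y)) , vertex-colour (R i) (c y)))

  module _ (thick : ∀ {g y} → g ∈ˡ E → y ∈ g → K (a ⊙ c y) < degree _⊆?_ E (g - y))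
           {m} (χ : Fin m → Fin (suc q)) where

    ⊙χ-injective : ∀ {x y} → a ⊙ χ x ≡ a ⊙ χ y → χ x ≡ χ y
    ⊙χ-injective eq = trans (sym (⊙-involutive a _)) (trans (cong (a ⊙_) eq) (⊙-involutive a _))

    -- A vertex y of f is the image of the vertex of e with colour a ⊙ c y: both lie in f and in the
    -- same class.
    image-rainbow : ∀ {φ e f} → Rainbow χ e → Rainbow c f →
                    (∀ {x} → x ∈ e → φ x ∈ f × c (φ x) ≡ a ⊙ χ x) → image φ e ≡ f
    image-rainbow {φ} {e} {f} Re Rf maps = ⊆-antisym image⊆f f⊆image
      where
      image⊆f : image φ e ⊆ f
      image⊆f y∈ = let x , x∈e , φx≡y = ∈-image⁻ φ y∈ in subst (_∈ f) φx≡y (proj₁ (maps x∈e))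
      f⊆image : f ⊆ image φ e
      f⊆image {y} y∈f = subst (_∈ image φ e) φx≡y (∈-image⁺ φ x∈e)
        where
        x = vertex Re (a ⊙ c y)
        x∈e = vertex-∈ Re (a ⊙ c y)
        φx≡y : φ x ≡ y
        φx≡y = rainbow-injective Rf (proj₁ (maps x∈e)) y∈f
          (trans (proj₂ (maps x∈e)) (trans (cong (a ⊙_) (vertex-colour Re _)) (⊙-involutive a (c y))))

    -- `φ` is total but constrained only on `V`. `used j` lists the vertices occupied by tree colour
    -- j; the successor in its bound accounts for the first edge.
    record Embedding (V : Subset m) (es : List (Subset m)) (k : Vector ℕ (suc q)) : Set where
      field
        φ           : Fin m → Fin n
        used        : Fin (suc q) → List (Fin n)
        φ-injective : ∀ {x y} → x ∈ V → y ∈ V → φ x ≡ φ y → x ≡ y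
        φ-colour    : ∀ {x} → x ∈ V → c (φ x) ≡ a ⊙ χ x
        φ-used      : ∀ {x} → x ∈ V → φ x ∈ˡ used (χ x)
        used-bound  : ∀ j → length (used j) ≤ suc (k j)
        φ-edge      : ∀ {e} → e ∈ˡ es → image φ e ∈ˡ E

    -- Any edge of `E` can host the first tree edge: each vertex goes to the vertex of the matching
    -- class.
    embed-start : ∀ {e} → Rainbow χ e → Embedding e [ e ] (const 0)
    embed-start {e} Re = record
      { φ           = φ₀
      ; used        = λ j → [ vertex Rf (a ⊙ j) ]
      ; φ-injective = λ x∈ y∈ eq → rainbow-injective Re x∈ y∈
          (⊙χ-injective (trans (sym (φ₀-colour _)) (trans (cong c eq) (φ₀-colour _))))
      ; φ-colour    = λ _ → φ₀-colour _
      ; φ-used      = λ _ → here refl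
      ; used-bound  = λ _ → s≤s z≤n
      ; φ-edge      = λ { (here refl) → subst (_∈ˡ E) (sym (image-rainbow Re Rf λ _ → vertex-∈ Rf _ , φ₀-colour _)) f∈E }
      }
      where
      f∈E : lookup E (fromℕ< E>0) ∈ˡ E
      f∈E = ∈-lookup (fromℕ< E>0)
      Rf = E-rainbow f∈E
      φ₀ : Fin m → Fin n
      φ₀ x = vertex Rf (a ⊙ χ x)
      φ₀-colour : ∀ x → c (φ₀ x) ≡ a ⊙ χ x
      φ₀-colour x = vertex-colour Rf (a ⊙ χ x)

    -- Injectivity survives because an old vertex mapped to u would have the colour of v, putting u
    -- into `used (χ v)`.
    embed-vertex : ∀ {V es e v k h u} → (∀ {e′} → e′ ∈ˡ es → e′ ⊆ V) → Rainbow χ e → v ∉ V →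
                   (emb : Embedding V es k) → let open Embedding emb in
                   h ∈ˡ E → u ∈ h → c u ≡ a ⊙ χ v → u ∉ˡ used (χ v) →
                   (∀ {x} → x ∈ e → x ≢ v → x ∈ V × φ x ∈ h) →
                   Embedding (V ∪ ⁅ v ⁆) (e ∷ es) (updateAt k (χ v) suc)
    embed-vertex {V} {es} {e} {v} {k} {h} {u} es⊆V Re v∉V emb h∈E u∈h cu u∉used e-v-maps = record
      { φ           = φ′
      ; used        = used′
      ; φ-injective = λ x∈ y∈ → φ′-injective (∈∪⁅⁆⁻ x∈) (∈∪⁅⁆⁻ y∈)
      ; φ-colour    = λ x∈ → φ′-colour (∈∪⁅⁆⁻ x∈)
      ; φ-used      = λ x∈ → φ′-used (∈∪⁅⁆⁻ x∈)
      ; used-bound  = used′-bound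
      ; φ-edge      = λ { (here refl) → subst (_∈ˡ E) (sym (image-rainbow Re (E-rainbow h∈E) e-maps)) h∈E
                        ; (there e′∈) → subst (_∈ˡ E) (image-cong (sym ∘ φ′-old ∘ es⊆V e′∈)) (φ-edge e′∈) }
      }
      where
      open Embedding emb
      φ′ : Fin m → Fin n
      φ′ = updateAt φ v (const u)
      φ′v : φ′ v ≡ u
      φ′v = updateAt-updates v φ
      φ′-old : ∀ {x} → x ∈ V → φ′ x ≡ φ x
      φ′-old x∈V = updateAt-const-≢ φ λ { refl → v∉V x∈V }

      φ′-colour : ∀ {x} → x ∈ V ⊎ x ≡ v → c (φ′ x) ≡ a ⊙ χ x
      φ′-colour (inj₁ x∈V)  = trans (cong c (φ′-old x∈V)) (φ-colour x∈V)
      φ′-colour (inj₂ refl) = trans (cong c φ′v) cu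

      φ-avoids-u : ∀ {x} → x ∈ V → φ x ≢ u
      φ-avoids-u {x} x∈V φx≡u = u∉used (subst (λ j → u ∈ˡ used j) χx≡χv (subst (_∈ˡ used (χ x)) φx≡u (φ-used x∈V)))
        where
        χx≡χv : χ x ≡ χ v
        χx≡χv = ⊙χ-injective (trans (sym (φ-colour x∈V)) (trans (cong c φx≡u) cu))

      φ′-injective : ∀ {x z} → x ∈ V ⊎ x ≡ v → z ∈ V ⊎ z ≡ v → φ′ x ≡ φ′ z → x ≡ z
      φ′-injective (inj₁ x∈V)  (inj₁ z∈V)  eq = φ-injective x∈V z∈V (trans (sym (φ′-old x∈V)) (trans eq (φ′-old z∈V)))
      φ′-injective (inj₁ x∈V)  (inj₂ refl) eq = contradiction (trans (sym (φ′-old x∈V)) (trans eq φ′v)) (φ-avoids-u x∈V)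
      φ′-injective (inj₂ refl) (inj₁ z∈V)  eq = contradiction (trans (sym (φ′-old z∈V)) (trans (sym eq) φ′v)) (φ-avoids-u z∈V)
      φ′-injective (inj₂ refl) (inj₂ refl) _  = refl

      used′ : Fin (suc q) → List (Fin n)
      used′ = updateAt used (χ v) (u ∷_)
      used′v : used′ (χ v) ≡ u ∷ used (χ v)
      used′v = updateAt-updates (χ v) used

      φ′-used : ∀ {x} → x ∈ V ⊎ x ≡ v → φ′ x ∈ˡ used′ (χ x)
      φ′-used (inj₂ refl)    = subst (φ′ v ∈ˡ_) (sym used′v) (here φ′v)
      φ′-used {x} (inj₁ x∈V) = subst (_∈ˡ used′ (χ x)) (sym (φ′-old x∈V)) old
        where
        old : φ x ∈ˡ used′ (χ x)
        old with χ x ≟ᶠ χ v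
        ... | yes eq = subst (λ j → φ x ∈ˡ used′ j) (sym eq) (subst (φ x ∈ˡ_) (sym used′v)
                         (there (subst (λ j → φ x ∈ˡ used j) eq (φ-used x∈V))))
        ... | no neq = subst (φ x ∈ˡ_) (sym (updateAt-minimal (χ x) (χ v) used neq)) (φ-used x∈V)

      used′-bound : ∀ j → length (used′ j) ≤ suc (updateAt k (χ v) suc j)
      used′-bound j with j ≟ᶠ χ v
      ... | yes refl = begin
        length (used′ (χ v))               ≡⟨ cong length used′v ⟩
        suc (length (used (χ v)))          ≤⟨ s≤s (used-bound (χ v)) ⟩
        suc (suc (k (χ v)))                ≡⟨ cong suc (updateAt-updates (χ v) k) ⟨
        suc (updateAt k (χ v) suc (χ v))   ∎
        where open ≤-Reasoning
      ... | no j≢χv = begin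
        length (used′ j)               ≡⟨ cong length (updateAt-minimal j (χ v) used j≢χv) ⟩
        length (used j)                ≤⟨ used-bound j ⟩
        suc (k j)                      ≡⟨ cong suc (updateAt-minimal j (χ v) k j≢χv) ⟨
        suc (updateAt k (χ v) suc j)   ∎
        where open ≤-Reasoning

      e-maps : ∀ {x} → x ∈ e → φ′ x ∈ h × c (φ′ x) ≡ a ⊙ χ x
      e-maps {x} x∈e with x ≟ᶠ v
      ... | yes refl = subst (_∈ h) (sym φ′v) u∈h , φ′-colour (inj₂ refl)
      ... | no  x≢v  = let x∈V , φx∈h = e-v-maps x∈e x≢v in
                       subst (_∈ h) (sym (φ′-old x∈V)) φx∈h , φ′-colour (inj₁ x∈V)

    -- Dropping from the image of f its vertex y in the class meant for v leaves a shadow set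
    -- containing the image of e - v. Its degree exceeds the number of occupied vertices of that
    -- class, so a fresh tip exists.
    embed-edge : ∀ {V es e f v k} → (∀ {e′} → e′ ∈ˡ es → e′ ⊆ V) → Rainbow χ e → v ∈ e → v ∉ V →
                 f ∈ˡ es → e - v ⊆ f → suc (k (χ v)) ≤ K (χ v) →
                 Embedding V es k → Embedding (V ∪ ⁅ v ⁆) (e ∷ es) (updateAt k (χ v) suc)
    embed-edge {V} {e = e} {f} {v} {k} es⊆V Re v∈e v∉V f∈es e-v⊆f k<K emb
      = let h , h∈E , g-y⊆h , u , u∈h , cu≡cy , u∉used = extend-edge {y = y} (used (χ v)) g∈E enough
        in embed-vertex es⊆V Re v∉V emb h∈E u∈h (trans cu≡cy cy) u∉used
             λ x∈e x≢v → x∈V x∈e x≢v , g-y⊆h (φx∈g-y x∈e x≢v)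
      where
      open Embedding emb
      g∈E : image φ f ∈ˡ E
      g∈E = φ-edge f∈es
      y : Fin n
      y = vertex (E-rainbow g∈E) (a ⊙ χ v)
      cy : c y ≡ a ⊙ χ v
      cy = vertex-colour (E-rainbow g∈E) (a ⊙ χ v)
      enough : length (used (χ v)) < degree _⊆?_ E (image φ f - y)
      enough = ≤-<-trans (≤-trans (used-bound (χ v)) k<K)
        (subst (λ i → K i < degree _⊆?_ E (image φ f - y)) (trans (cong (a ⊙_) cy) (⊙-involutive a (χ v)))
          (thick g∈E (vertex-∈ (E-rainbow g∈E) (a ⊙ χ v))))
      x∈f : ∀ {x} → x ∈ e → x ≢ v → x ∈ f
      x∈f x∈e x≢v = e-v⊆f (x∈p∧x≢y⇒x∈p-y x∈e x≢v)
      x∈V : ∀ {x} → x ∈ e → x ≢ v → x ∈ V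
      x∈V x∈e x≢v = es⊆V f∈es (x∈f x∈e x≢v)
      φx∈g-y : ∀ {x} → x ∈ e → x ≢ v → φ x ∈ image φ f - y
      -- If x were mapped to y, it would have the colour of v, so x = v since e is rainbow.
      φx∈g-y x∈e x≢v = x∈p∧x≢y⇒x∈p-y (∈-image⁺ φ (x∈f x∈e x≢v)) λ φx≡y →
        x≢v (rainbow-injective Re x∈e v∈e
          (⊙χ-injective (trans (sym (φ-colour (x∈V x∈e x≢v))) (trans (cong c φx≡y) cy))))

    embed : ∀ {V es} (d : TightConstruction (suc q) V es) → (∀ {e} → e ∈ˡ es → Rainbow χ e) →
            (∀ j → growthCount χ d j ≤ K j) → Embedding V es (growthCount χ d)
    embed (start _) R _ = embed-start (R (here refl))
    embed (grow {v = v} d _ v∈e v∉V f∈ e-v⊆f) R k≤K = embed-edge (construction-⊆ d) (R (here refl)) v∈e v∉V f∈ e-v⊆f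
      -- At colour `χ v` the count after this step is the successor of the old one, which yields the
      -- strict slack required.
      (subst (_≤ K (χ v)) (updateAt-updates (χ v) (growthCount χ d)) (k≤K (χ v)))
      (embed d (R ∘ there) λ j → ≤-trans (≤-updateAt-suc (growthCount χ d) (χ v) j) (k≤K j))

-- Choosing a row of the Latin square and combining pruning with embedding

∈-∂ : ∀ {q n} (H : RGraph (suc q) n) {e v} → e ∈E H → v ∈ e → (e - v) ∈ˡ ∂ H
∈-∂ H {e} {v} e∈H v∈e = ∈-filter⁺ (inShadow? H) (∈-allSubsets (e - v))
  ( suc-injective (trans (sym (∣p∣≡1+∣p-x∣ v∈e)) (All.lookup (uniform H) e∈H))
  , lose e∈H (p-x⊆p e v))

containment : ∀ {q n m} (H : RGraph (suc q) n) → IsPartite H → (T : RGraph (suc q) m) → IsTightTree T →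
              (∣E T ∣ ∸ 1) * ∣∂ H ∣ < suc q * ∣E H ∣ → H Contains T
containment {q} {n} {m} H (c , partite) T (es , d , es↭T) dense = φ ,
  (λ {x} {y} → φ-injective {x} {y} ∈⊤ ∈⊤) , λ e e∈T → φ-edgeᴴ (∈-resp-↭ (↭-sym es↭T) e∈T)
  where
  open LatinSquare q
  colouring = tight-tree-colouring d
  χ = proj₁ colouring
  K = growthCount χ d
  -- Under row `a`, a shadow set is charged the growth count of the tree colour matched with the
  -- class it misses.
  weight : Fin (suc q) → Subset n → ℕ
  weight a s = K (a ⊙ missing c s)
  sum-K : sum K ≡ ∣E T ∣ ∸ 1
  sum-K = cong (_∸ 1) (trans (suc-sum-growthCount χ d) (↭-length es↭T))
  average : ∃ λ a → sumˡ (map (weight a) (∂ H)) < ∣E H ∣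
  -- The weights of all rows add up to (t - 1)|∂H|, which is below r|E(H)|, so some row has weight
  -- below |E(H)|.
  average = sum<*⇒∃< (λ a → sumˡ (map (weight a) (∂ H))) ∣E H ∣
    (≤-<-trans (≤-reflexive (sum-sumˡ weight (λ s → trans (sum-⊙ K (missing c s)) sum-K) (∂ H))) dense)
  a = proj₁ average
  pruned = Pruning.prune _⊆?_ (weight a) (∣∂ H ∣) (∂ H) (edges H) ≤-refl (proj₂ average) (unique H)
  E = proj₁ pruned
  E⊆H : ∀ {e} → e ∈ˡ E → e ∈E H
  E⊆H = proj₁ (proj₂ (proj₂ pruned))
  E-rainbow : ∀ {e} → e ∈ˡ E → Rainbow c e
  E-rainbow e∈E = partite _ (E⊆H e∈E)
  thick : ∀ {g y} → g ∈ˡ E → y ∈ g → K (a ⊙ c y) < degree _⊆?_ E (g - y)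
  -- The edge g itself survives above g - y, so thickness is not vacuous here.
  thick {g} {y} g∈E y∈g = subst (λ i → K (a ⊙ i) < degree _⊆?_ E (g - y)) (missing-remove (E-rainbow g∈E) y∈g)
    (proj₂ (proj₂ (proj₂ (proj₂ pruned))) (∈-∂ H (E⊆H g∈E) y∈g) (lose g∈E (p-x⊆p g y)))
  embedding = Greedy.embed c E (proj₁ (proj₂ (proj₂ (proj₂ pruned)))) E-rainbow (proj₁ (proj₂ pruned)) a K thick χ
    d (proj₂ colouring) (λ _ → ≤-refl)
  open Greedy.Embedding embedding
  φ-edgeᴴ : ∀ {e} → e ∈ˡ es → image φ e ∈E H
  φ-edgeᴴ = E⊆H ∘ φ-edge

-- Opened only here, since the constructor `+_` makes the sections (n +_) above
-- ambiguous.
open import Data.Integer.Base using (+_)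

-- The order on unnormalised rationals is cross-multiplication of integers; it remains to remove the
-- denominators 1 and return to naturals.
density-ℕ : ∀ q k e s → + e / 1 > (+ k / suc q) *ℚ (+ s / 1) → k * s < suc q * e
density-ℕ q k e s (*<* p) = subst (k * s <_) (trans (cong (e *_) (*-identityʳ (suc q))) (*-comm e (suc q))) (ℤ.drop‿+<+ (subst₂ ℤ._<_
  (trans (ℤ.*-identityʳ (+ k ℤ.* + s)) (sym (ℤ.pos-* k s)))
  (sym (ℤ.pos-* e (suc q * 1))) p))

theorem1p2 : ∀ (r t : ℕ) .{{_ : NonZero r}} → 2 ≤ r → 1 ≤ t →
    ∀ {n : ℕ} (H : RGraph r n) → IsPartite H →
    + ∣E H ∣ / 1 > (+ (t ∸ 1) / r) *ℚ (+ ∣∂ H ∣ / 1) →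
    ∀ {m : ℕ} (T : RGraph r m) → IsTightTree T → ∣E T ∣ ≡ t →
    H Contains T
theorem1p2 (suc q) _ _ _ H partite dense T tight refl =
  containment H partite T tight (density-ℕ q (∣E T ∣ ∸ 1) ∣E H ∣ ∣∂ H ∣ dense)
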